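{- The languages $\mathcal{L}(\blacktriangle)$ and $\mathcal{L}(\Delta)$ are equally expressive on the class of reflexive models ($\mathcal{T}$-models).
   Context: Let $\mathbf{P}$ be a set of propositional variables. $\mathcal{L}(\blacktriangle)$-formulas: $\varphi::=\top\mid p\mid\neg\varphi\mid(\varphi\land\varphi)\mid\blacktriangle\varphi$ with $p\in\mathbf{P}$. $\mathcal{L}(\Delta)$-formulas: the same with $\Delta\varphi$ in place of $\blacktriangle\varphi$. A model is $\mathcal{M}=\langle S,R,V\rangle$ with $S$ a nonempty set, $R\subseteq S\times S$, $V:\mathbf{P}\to\mathcal{P}(S)$; it is reflexive if $R$ is. A pointed model is a pair $(\mathcal{M},s)$ with $s\in S$. Truth: $\top$, variables, $\neg,\land$ as usual; $\mathcal{M},s\vDash\Delta\varphi$ iff for all $t_1,t_2$ with $sRt_1$ and $sRt_2$: ($\mathcal{M},t_1\vDash\varphi$ iff $\mathcal{M},t_2\vDash\varphi$); $\mathcal{M},s\vDash\blacktriangle\varphi$ iff (if $\mathcal{M},s\vDash\varphi$ then $\mathcal{M},t\vDash\varphi$ for all $t$ with $sRt$) and (if $\mathcal{M},s\nvDash\varphi$ then $\mathcal{M},t\nvDash\varphi$ for all $t$ with $sRt$). Expressivity on a class $\mathbb{M}$ of models: $\mathcal{L}_1\preceq\mathcal{L}_2$ if for every $\varphi\in\mathcal{L}_1$ there is $\psi\in\mathcal{L}_2$ such that for every pointed model $(\mathcal{M},s)$ with $\mathcal{M}\in\mathbb{M}$, $\mathcal{M},s\vDash\varphi$ iff $\mathcal{M},s\vDash\psi$.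 $\mathcal{L}_1$ and $\mathcal{L}_2$ are equally expressive if $\mathcal{L}_1\preceq\mathcal{L}_2$ and $\mathcal{L}_2\preceq\mathcal{L}_1$. -}

module Defs where

open import Data.Product using (_×_; ∃)
open import Data.Unit.Polymorphic using () renaming (⊤ to Unit)
open import Function.Bundles using (_⇔_)
open import Level using (Level; _⊔_) renaming (suc to lsuc)
open import Relation.Binary.Core using (Rel)
open import Relation.Binary.Definitions using (Reflexive)
open import Relation.Nullary using (¬_)
open import Relation.Unary using (Pred)

infix  8 ~_ ▲_ Δ_
infixr 7 _∧_

data 𝓛▲ {p : Level} (P : Set p) : Set p where
  ⊤   : 𝓛▲ P
  var : P → 𝓛▲ P
  ~_  : 𝓛▲ P → 𝓛▲ P
  _∧_ : 𝓛▲ P → 𝓛▲ P → 𝓛▲ P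
  ▲_  : 𝓛▲ P → 𝓛▲ P

data 𝓛Δ {p : Level} (P : Set p) : Set p where
  ⊤   : 𝓛Δ P
  var : P → 𝓛Δ P
  ~_  : 𝓛Δ P → 𝓛Δ P
  _∧_ : 𝓛Δ P → 𝓛Δ P → 𝓛Δ P
  Δ_  : 𝓛Δ P → 𝓛Δ P

-- Subsets are arbitrary predicates, with no decidability or stability built
-- in: the semantics is classical only in the presence of excluded middle.
record Model {p : Level} (P : Set p) (ℓ : Level) : Set (p ⊔ lsuc ℓ) where
  field
    S        : Set ℓ
    nonempty : S
    R        : Rel S ℓ
    V        : P → Pred S ℓ

open Model public

infix 4 _,_⊨▲_ _,_⊨Δ_

_,_⊨▲_ : {p ℓ : Level} {P : Set p} (M : Model P ℓ) → S M → 𝓛▲ P → Set ℓ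
M , s ⊨▲ ⊤     = Unit
M , s ⊨▲ var x = V M x s
M , s ⊨▲ ~ φ   = ¬ (M , s ⊨▲ φ)
M , s ⊨▲ φ ∧ ψ = (M , s ⊨▲ φ) × (M , s ⊨▲ ψ)
M , s ⊨▲ ▲ φ   =
  (M , s ⊨▲ φ → ∀ t → R M s t → M , t ⊨▲ φ) ×
  (¬ (M , s ⊨▲ φ) → ∀ t → R M s t → ¬ (M , t ⊨▲ φ))

_,_⊨Δ_ : {p ℓ : Level} {P : Set p} (M : Model P ℓ) → S M → 𝓛Δ P → Set ℓ
M , s ⊨Δ ⊤     = Unit
M , s ⊨Δ var x = V M x s
M , s ⊨Δ ~ φ   = ¬ (M , s ⊨Δ φ)
M , s ⊨Δ φ ∧ ψ = (M , s ⊨Δ φ) × (M , s ⊨Δ ψ)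
M , s ⊨Δ Δ φ   =
  ∀ t₁ t₂ → R M s t₁ → R M s t₂ → (M , t₁ ⊨Δ φ) ⇔ (M , t₂ ⊨Δ φ)

record Language {p : Level} (P : Set p) (ℓ : Level) : Set (lsuc (p ⊔ ℓ)) where
  field
    Formula : Set p
    Sat     : (M : Model P ℓ) → S M → Formula → Set ℓ

open Language public

L▲ : {p : Level} (P : Set p) (ℓ : Level) → Language P ℓ
L▲ P ℓ = record { Formula = 𝓛▲ P ; Sat = _,_⊨▲_ }

LΔ : {p : Level} (P : Set p) (ℓ : Level) → Language P ℓ
LΔ P ℓ = record { Formula = 𝓛Δ P ; Sat = _,_⊨Δ_ }

AtMostAsExpressiveOn : {p ℓ c : Level} {P : Set p} →
  Pred (Model P ℓ) c → Language P ℓ → Language P ℓ → Set (p ⊔ lsuc ℓ ⊔ c)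
AtMostAsExpressiveOn C L₁ L₂ =
  (φ : Formula L₁) → ∃ λ (ψ : Formula L₂) →
    ∀ M → C M → (s : S M) → Sat L₁ M s φ ⇔ Sat L₂ M s ψ

EquallyExpressiveOn : {p ℓ c : Level} {P : Set p} →
  Pred (Model P ℓ) c → Language P ℓ → Language P ℓ → Set (p ⊔ lsuc ℓ ⊔ c)
EquallyExpressiveOn C L₁ L₂ =
  AtMostAsExpressiveOn C L₁ L₂ × AtMostAsExpressiveOn C L₂ L₁

ReflexiveModel : {p ℓ : Level} {P : Set p} → Pred (Model P ℓ) ℓ
ReflexiveModel M = Reflexive (R M)

{-# OPTIONS --safe #-}
module Submission where

-- At a reflexive point s, agreement of all successors of s with s on φ is the
-- same as agreement of all successors of s with one another: s is itself a
-- successor. So reading ▲ as Δ (and back) preserves truth.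

open import Defs
open import Axiom.ExcludedMiddle using (ExcludedMiddle)
open import Level using (Level)
open import Data.Product using (_×_; _,_)
open import Data.Product.Function.NonDependent.Propositional using (_×-⇔_)
open import Function.Base using (const)
open import Function.Bundles using (_⇔_; mk⇔; Equivalence)
open import Function.Construct.Identity using (⇔-id)
open import Function.Construct.Symmetry using (⇔-sym)
open import Relation.Binary.PropositionalEquality using (_≡_; refl; cong; cong₂; subst)
open import Relation.Nullary using (¬_; Dec; yes; no; contradiction)
open import Relation.Nullary.Negation using (contraposition)
open import Relation.Unary using (Pred)

open Equivalence using (to; from)

private
  variable
    p ℓ a r : Level

toΔ : {P : Set p} → 𝓛▲ P → 𝓛Δ P
toΔ ⊤       = ⊤
toΔ (var x) = var x
toΔ (~ φ)   = ~ toΔ φ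
toΔ (φ ∧ ψ) = toΔ φ ∧ toΔ ψ
toΔ (▲ φ)   = Δ toΔ φ

to▲ : {P : Set p} → 𝓛Δ P → 𝓛▲ P
to▲ ⊤       = ⊤
to▲ (var x) = var x
to▲ (~ φ)   = ~ to▲ φ
to▲ (φ ∧ ψ) = to▲ φ ∧ to▲ ψ
to▲ (Δ φ)   = ▲ to▲ φ

-- Lets the correctness of `toΔ` serve for `to▲` as well, so that one induction settles both
-- directions.
toΔ-to▲ : {P : Set p} (φ : 𝓛Δ P) → toΔ (to▲ φ) ≡ φ
toΔ-to▲ ⊤       = refl
toΔ-to▲ (var x) = refl
toΔ-to▲ (~ φ)   = cong ~_ (toΔ-to▲ φ)
toΔ-to▲ (φ ∧ ψ) = cong₂ _∧_ (toΔ-to▲ φ) (toΔ-to▲ ψ)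
toΔ-to▲ (Δ φ)   = cong Δ_ (toΔ-to▲ φ)

¬-cong : {A B : Set a} → A ⇔ B → (¬ A) ⇔ (¬ B)
¬-cong e = mk⇔ (contraposition (from e)) (contraposition (to e))

-- The modal case, stripped of syntax: `T` stands for the successors of `s`, and `A` and `B` for the
-- truth sets of a formula and of its translation.
agree-with⇔agree-among : {S : Set a} {T : Pred S r} {A B : Pred S ℓ} {s : S} →
  Dec (A s) → T s → (∀ t → A t ⇔ B t) →
  ((A s → ∀ t → T t → A t) × (¬ A s → ∀ t → T t → ¬ A t)) ⇔
  (∀ t₁ t₂ → T t₁ → T t₂ → B t₁ ⇔ B t₂)
agree-with⇔agree-among {T = T} {A} {B} {s} A? Ts A⇔B = mk⇔ (among A?) with-s
  where
  among : Dec (A s) → (A s → ∀ t → T t → A t) × (¬ A s → ∀ t → T t → ¬ A t) →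
          ∀ t₁ t₂ → T t₁ → T t₂ → B t₁ ⇔ B t₂
  -- The decision on `A s` selects the clause that applies: either `A` holds throughout `T`, or it
  -- fails throughout.
  among (yes As) (all , _) t₁ t₂ Tt₁ Tt₂ =
    mk⇔ (const (to (A⇔B t₂) (all As t₂ Tt₂))) (const (to (A⇔B t₁) (all As t₁ Tt₁)))
  among (no ¬As) (_ , none) t₁ t₂ Tt₁ Tt₂ =
    mk⇔ (λ Bt₁ → contradiction (from (A⇔B t₁) Bt₁) (none ¬As t₁ Tt₁))
        (λ Bt₂ → contradiction (from (A⇔B t₂) Bt₂) (none ¬As t₂ Tt₂))

  with-s : (∀ t₁ t₂ → T t₁ → T t₂ → B t₁ ⇔ B t₂) →
           (A s → ∀ t → T t → A t) × (¬ A s → ∀ t → T t → ¬ A t)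
  -- By `Ts`, the point `s` itself can be the first of the two points compared.
  with-s agree =
    (λ As t Tt → from (A⇔B t) (to (agree s t Ts Tt) (to (A⇔B s) As))) ,
    (λ ¬As t Tt At → ¬As (from (A⇔B s) (from (agree s t Ts Tt) (to (A⇔B t) At))))

toΔ-correct : {P : Set p} → ExcludedMiddle ℓ → (φ : 𝓛▲ P) →
  (M : Model P ℓ) → ReflexiveModel M → (s : S M) →
  (M , s ⊨▲ φ) ⇔ (M , s ⊨Δ toΔ φ)
toΔ-correct em ⊤       M rfl s = ⇔-id _
toΔ-correct em (var x) M rfl s = ⇔-id _
toΔ-correct em (~ φ)   M rfl s = ¬-cong (toΔ-correct em φ M rfl s)
toΔ-correct em (φ ∧ ψ) M rfl s = toΔ-correct em φ M rfl s ×-⇔ toΔ-correct em ψ M rfl s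
toΔ-correct em (▲ φ)   M rfl s =
  -- Excluded middle decides `φ` at `s`, and reflexivity makes `s` its own successor. The induction
  -- hypothesis is passed for all points, since both modalities look at successors.
  agree-with⇔agree-among {T = R M s} em rfl (toΔ-correct em φ M rfl)

proposition14 : {p ℓ : Level} → ExcludedMiddle ℓ → (P : Set p) →
    EquallyExpressiveOn ReflexiveModel (L▲ P ℓ) (LΔ P ℓ)
proposition14 em P =
  (λ φ → toΔ φ , toΔ-correct em φ) ,
  (λ φ → to▲ φ , λ M rfl s →
    ⇔-sym (subst (λ χ → (M , s ⊨▲ to▲ φ) ⇔ (M , s ⊨Δ χ)) (toΔ-to▲ φ)
                 (toΔ-correct em (to▲ φ) M rfl s)))
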